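{- For every integer $n > 2$, the tensor product graph $P_n \wedge P_5$ is odd graceful.
   Context: All graphs are finite and simple. $P_n$ denotes the path graph on $n$ vertices. The tensor product $G_1 \wedge G_2$ of two graphs $G_1, G_2$ is the graph with vertex set $V(G_1) \times V(G_2)$ in which $(u_1,v_1)$ and $(u_2,v_2)$ are adjacent if and only if $u_1u_2 \in E(G_1)$ and $v_1v_2 \in E(G_2)$. An odd graceful labeling of a graph $G$ with $q = |E(G)|$ edges is a one-to-one function $f : V(G) \to \{0,1,2,\ldots,2q-1\}$ such that, when each edge $uv$ is given the label $f^*(uv) = |f(u)-f(v)|$, the resulting set of edge labels is exactly $\{1,3,5,\ldots,2q-1\}$ (so the $q$ edge labels are distinct). A graph is odd graceful if it has an odd graceful labeling. -}

module Defs where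

open import Data.Fin.Base using (Fin; toℕ)
open import Data.Fin.Properties using (*↔×)
open import Data.Nat.Base using (ℕ; suc; _+_; _*_; _<_; ∣_-_∣)
open import Data.Nat.Properties using (_≟_; 1+n≢n)
open import Data.Product.Base using (Σ; ∃-syntax; _×_; _,_; proj₁; swap; map)
open import Data.Product.Function.NonDependent.Propositional using (_×-↔_)
open import Data.Sum.Base using (_⊎_; inj₁; inj₂; [_,_]′)
import Data.Sum.Base as Sum
open import Function.Base using (_∘_)
open import Function.Bundles using (_↔_; _⇔_; Bijection)
open import Function.Construct.Composition using (_↔-∘_)
open import Function.Construct.Identity using (↔-id)
open import Function.Construct.Symmetry using (↔-sym)
open import Function.Definitions using (Injective)
open import Level using (0ℓ)
open import Relation.Binary.Bundles using (Setoid)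
open import Relation.Binary.Definitions using (Decidable; Symmetric)
open import Relation.Binary.PropositionalEquality
  using (_≡_; refl; sym; trans; cong; setoid)
open import Relation.Nullary.Decidable using (_×-dec_; _⊎-dec_)
open import Relation.Nullary.Negation using (¬_)

record Graph : Set₁ where
  field
    Vertex     : Set
    order      : ℕ
    finite     : Vertex ↔ Fin order
    Adj        : Vertex → Vertex → Set
    adj?       : Decidable Adj
    adj-sym    : Symmetric Adj
    adj-irrefl : ∀ {v} → ¬ Adj v v

open Graph

-- An edge uv is an unordered pair: (u , v) and (v , u) are the same edge,
-- and the proof of adjacency is irrelevant.
module _ (G : Graph) where

  Edge : Set
  Edge = Σ (Vertex G × Vertex G) λ (u , v) → Adj G u v

  _≈ᴱ_ : Edge → Edge → Set
  (p , _) ≈ᴱ (p′ , _) = p ≡ p′ ⊎ p ≡ swap p′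

  edgeSetoid : Setoid 0ℓ 0ℓ
  edgeSetoid = record
    { Carrier       = Edge
    ; _≈_           = _≈ᴱ_
    ; isEquivalence = record
      { refl  = inj₁ refl
      ; sym   = Sum.map sym (sym ∘ cong swap)
      ; trans = λ where
          (inj₁ a) (inj₁ b) → inj₁ (trans a b)
          (inj₁ a) (inj₂ b) → inj₂ (trans a b)
          (inj₂ a) (inj₁ b) → inj₂ (trans a (cong swap b))
          (inj₂ a) (inj₂ b) → inj₁ (trans a (cong swap b))
      }
    }

-- |E(G)| = q.  Such a q is unique, since Fin q determines q.
HasSize : Graph → ℕ → Set
HasSize G q = Bijection (setoid (Fin q)) (edgeSetoid G)

path : ℕ → Graph
path n = record
  { Vertex     = Fin n
  ; order      = n
  ; finite     = ↔-id (Fin n)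
  ; Adj        = λ i j → suc (toℕ i) ≡ toℕ j ⊎ suc (toℕ j) ≡ toℕ i
  ; adj?       = λ i j → (suc (toℕ i) ≟ toℕ j) ⊎-dec (suc (toℕ j) ≟ toℕ i)
  ; adj-sym    = Sum.swap
  ; adj-irrefl = [ 1+n≢n , 1+n≢n ]′
  }

infixr 7 _∧_

_∧_ : Graph → Graph → Graph
G₁ ∧ G₂ = record
  { Vertex     = Vertex G₁ × Vertex G₂
  ; order      = order G₁ * order G₂
  ; finite     = ↔-sym *↔× ↔-∘ (finite G₁ ×-↔ finite G₂)
  ; Adj        = λ (u₁ , v₁) (u₂ , v₂) → Adj G₁ u₁ u₂ × Adj G₂ v₁ v₂
  ; adj?       = λ (u₁ , v₁) (u₂ , v₂) → adj? G₁ u₁ u₂ ×-dec adj? G₂ v₁ v₂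
  ; adj-sym    = map (adj-sym G₁) (adj-sym G₂)
  ; adj-irrefl = adj-irrefl G₁ ∘ proj₁
  }

record IsOddGracefulLabeling (G : Graph) (q : ℕ) (f : Vertex G → ℕ) : Set where
  field
    injective : Injective _≡_ _≡_ f
    bounded   : ∀ v → f v < 2 * q
    -- the set of edge labels is {1, 3, …, 2q - 1}
    labels    : ∀ m → (∃[ u ] ∃[ v ] Adj G u v × ∣ f u - f v ∣ ≡ m)
                      ⇔ (∃[ k ] k < q × m ≡ 2 * k + 1)

OddGraceful : Graph → Set
OddGraceful G =
  ∃[ q ] HasSize G q × (∃[ f ] IsOddGracefulLabeling G q f)

{-# OPTIONS --safe #-}

-- Write n = m + 1, so that there are q = 8m edges. Label the even columns of
-- the grid by small even numbers and the odd columns by large odd numbers: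
--
--   f (2k , j) = 16k + 2 a_j,   f (2k + 1 , j) = 16m - 1 - 16k - 2 b_j.
--
-- An edge between columns g and g + 1 then has label 16(m - g) - 1 - 2s, where
-- s = a_j + b_j′ for adjacent rows j, j′. Taking a = (4,0,3,1,2) and
-- b = (2,3,0,1,4), these eight sums are 0, …, 7, so each pair of consecutive
-- columns uses up exactly one block of eight consecutive odd labels.
--
-- Exchanging a and b turns the labelling f′ of m columns into the one of m + 1
-- columns by f (i + 1 , j) = 16m - 1 - f′ (i , j), which allows induction on m.
module Submission where

open import Defs
open import Data.Bool.Base using (Bool; true; false; not)
open import Data.Fin using (#_)
open import Data.Fin.Base
  using (Fin; zero; suc; toℕ; fromℕ<; inject₁; opposite; combine; remQuot)
open import Data.Fin.Properties
  using (toℕ<n; toℕ-injective; toℕ-fromℕ; toℕ-fromℕ<; toℕ-inject₁; toℕ-combine;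
         remQuot-combine; combine-remQuot; opposite-involutive; all?; any?)
  renaming (_≟_ to _≟ᶠ_)
open import Data.Nat.Base
  using (ℕ; zero; suc; _+_; _*_; _∸_; _≤_; _<_; _>_; s≤s; ∣_-_∣)
open import Data.Nat.Properties
  using (_≟_; _≤?_; ≤-trans; ≤-refl; <⇒≤; <⇒≢; m≤m+n; m∸n≤m; m+n∸m≡n; m+[n∸m]≡n;
         ∸-monoʳ-≤; ∸-cancelˡ-≡; +-monoʳ-≤; +-cancelʳ-≡; *-cancelˡ-≡;
         *-monoʳ-≤; ∣-∣-comm; ∣m+n-m+o∣≡∣n-o∣; ∣m-m+n∣≡n; module ≤-Reasoning)
open import Data.Nat.Tactic.RingSolver using (solve-∀)
open import Data.Product.Base using (∃-syntax; _×_; _,_; proj₁; proj₂)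
open import Data.Product.Properties using (≡-dec)
open import Data.Sum.Base using (inj₁; inj₂)
open import Data.Vec.Base using ([]; _∷_; lookup)
open import Function.Bundles using (mk⇔)
open import Function.Definitions using (Injective)
open import Relation.Binary.PropositionalEquality
  using (_≡_; _≢_; refl; sym; trans; cong; cong₂; subst; module ≡-Reasoning)
open import Relation.Nullary.Decidable using (from-yes; ¬?; _→-dec_)
open import Relation.Nullary.Negation using (contradiction)

open Graph

module _ (G : Graph) (f : Vertex G → ℕ) where

  edgeLabel : Edge G → ℕ
  edgeLabel ((u , v) , _) = ∣ f u - f v ∣

  edgeLabel-cong : ∀ e e′ → _≈ᴱ_ G e e′ → edgeLabel e ≡ edgeLabel e′
  edgeLabel-cong _ _ (inj₁ refl) = refl
  edgeLabel-cong _ ((u , v) , _) (inj₂ refl) = ∣-∣-comm (f v) (f u)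

  -- Listing the edges in the order of their labels settles two things at once. Equal edges have
  -- equal labels, so `label` forces `e` to be injective. With `cover` this gives the size `q`, and
  -- the labels met are then exactly the numbers `2 * k + 1` with `k < q`.
  oddGraceful-byEnumeration :
    ∀ q (e : Fin q → Edge G) →
    (∀ k → edgeLabel (e k) ≡ 2 * toℕ k + 1) →
    (∀ d → ∃[ k ] _≈ᴱ_ G (e k) d) →
    Injective _≡_ _≡_ f → (∀ v → f v < 2 * q) →
    OddGraceful G
  oddGraceful-byEnumeration q e label cover inj bnd = q , size , f , record
    { injective = inj
    ; bounded   = bnd
    ; labels    = λ m → mk⇔ (sound m) (complete m)
    }
    where
    label-injective : ∀ {k l} → 2 * toℕ k + 1 ≡ 2 * toℕ l + 1 → k ≡ l
    label-injective {k} {l} eq =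
      toℕ-injective (*-cancelˡ-≡ (toℕ k) (toℕ l) 2 (+-cancelʳ-≡ 1 _ _ eq))

    size : HasSize G q
    size = record
      { to        = e
      ; cong      = λ { refl → inj₁ refl }
      ; bijective =
          (λ {k} {l} eq → label-injective
            (trans (sym (label k)) (trans (edgeLabel-cong (e k) (e l) eq) (label l))))
        , (λ d → proj₁ (cover d) , λ { refl → proj₂ (cover d) })
      }

    sound : ∀ m → ∃[ u ] ∃[ v ] Adj G u v × ∣ f u - f v ∣ ≡ m →
            ∃[ k ] k < q × m ≡ 2 * k + 1
    sound m (u , v , uv , refl) with k , ek≈d ← cover ((u , v) , uv) =
      toℕ k , toℕ<n k ,
      trans (sym (edgeLabel-cong (e k) ((u , v) , uv) ek≈d)) (label k)

    complete : ∀ m → ∃[ k ] k < q × m ≡ 2 * k + 1 →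
               ∃[ u ] ∃[ v ] Adj G u v × ∣ f u - f v ∣ ≡ m
    complete m (k , k<q , refl) with ((u , v) , uv) ← e (fromℕ< k<q) in eq =
      u , v , uv ,
      trans (cong edgeLabel (sym eq))
        (trans (label (fromℕ< k<q)) (cong (λ x → 2 * x + 1) (toℕ-fromℕ< k<q)))

-- Adding `m + n` to both terms removes the truncated subtractions and leaves `o + n` and `o + m`.
∣o∸m-o∸n∣≡∣m-n∣ : ∀ {m n o} → m ≤ o → n ≤ o → ∣ o ∸ m - o ∸ n ∣ ≡ ∣ m - n ∣
∣o∸m-o∸n∣≡∣m-n∣ {m} {n} {o} m≤o n≤o = begin
  ∣ o ∸ m - o ∸ n ∣                           ≡⟨ ∣m+n-m+o∣≡∣n-o∣ (m + n) _ _ ⟨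
  ∣ m + n + (o ∸ m) - m + n + (o ∸ n) ∣       ≡⟨ cong₂ ∣_-_∣ eq₁ eq₂ ⟩
  ∣ o + n - o + m ∣                           ≡⟨ ∣m+n-m+o∣≡∣n-o∣ o n m ⟩
  ∣ n - m ∣                                   ≡⟨ ∣-∣-comm n m ⟩
  ∣ m - n ∣                                   ∎
  where
  open ≡-Reasoning
  swapʳ : ∀ x y z → x + y + z ≡ x + z + y
  swapʳ = solve-∀
  swapˡ : ∀ x y z → x + y + z ≡ y + z + x
  swapˡ = solve-∀
  eq₁ : m + n + (o ∸ m) ≡ o + n
  eq₁ = trans (swapʳ m n (o ∸ m)) (cong (_+ n) (m+[n∸m]≡n m≤o))
  eq₂ : m + n + (o ∸ n) ≡ o + m
  eq₂ = trans (swapˡ m n (o ∸ n)) (cong (_+ m) (m+[n∸m]≡n n≤o))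

-- weight false = a, weight true = b
weight : Bool → Fin 5 → ℕ
weight false = lookup (4 ∷ 0 ∷ 3 ∷ 1 ∷ 2 ∷ [])
weight true  = lookup (2 ∷ 3 ∷ 0 ∷ 1 ∷ 4 ∷ [])

weight≤4 : ∀ s j → weight s j ≤ 4
weight≤4 false = from-yes (all? λ j → weight false j ≤? 4)
weight≤4 true  = from-yes (all? λ j → weight true j ≤? 4)

weight-injective : ∀ s j j′ → weight s j ≡ weight s j′ → j ≡ j′
weight-injective false = from-yes (all? λ j → all? λ j′ →
  (weight false j ≟ weight false j′) →-dec (j ≟ᶠ j′))
weight-injective true = from-yes (all? λ j → all? λ j′ →
  (weight true j ≟ weight true j′) →-dec (j ≟ᶠ j′))

-- The pair of adjacent rows j, j′ with a_j + b_j′ = 7 - t; the entries are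
-- exchanged when the roles of a and b are.
rows : Bool → Fin 8 → Fin 5 × Fin 5
rows false = lookup
  ((# 0 , # 1) ∷ (# 2 , # 1) ∷ (# 3 , # 4) ∷ (# 2 , # 3) ∷
   (# 4 , # 3) ∷ (# 1 , # 0) ∷ (# 3 , # 2) ∷ (# 1 , # 2) ∷ [])
rows true t = proj₂ (rows false t) , proj₁ (rows false t)

rows-adjacent : ∀ s t → Adj (path 5) (proj₁ (rows s t)) (proj₂ (rows s t))
rows-adjacent false = from-yes (all? λ t →
  adj? (path 5) (proj₁ (rows false t)) (proj₂ (rows false t)))
rows-adjacent true = from-yes (all? λ t →
  adj? (path 5) (proj₁ (rows true t)) (proj₂ (rows true t)))

rows-surjective : ∀ s j j′ → Adj (path 5) j j′ → ∃[ t ] rows s t ≡ (j , j′)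
rows-surjective false = from-yes (all? λ j → all? λ j′ →
  adj? (path 5) j j′ →-dec any? λ t → ≡-dec _≟ᶠ_ _≟ᶠ_ (rows false t) (j , j′))
rows-surjective true = from-yes (all? λ j → all? λ j′ →
  adj? (path 5) j j′ →-dec any? λ t → ≡-dec _≟ᶠ_ _≟ᶠ_ (rows true t) (j , j′))

rows-weight : ∀ s t →
  weight (not s) (proj₂ (rows s t)) + weight s (proj₁ (rows s t)) + toℕ t ≡ 7
rows-weight false = from-yes (all? λ t →
  weight true (proj₂ (rows false t)) + weight false (proj₁ (rows false t)) + toℕ t ≟ 7)
rows-weight true = from-yes (all? λ t →
  weight false (proj₂ (rows true t)) + weight true (proj₁ (rows true t)) + toℕ t ≟ 7)

-- `m` counts the pairs of consecutive columns and `s` selects the weights of column zero. The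
-- constant `15 + 16 * m` is 16(m + 1) - 1, the greatest label allowed for `suc m` pairs.
labelling : ∀ m → Bool → Fin (suc m) → Fin 5 → ℕ
labelling m       s zero    j = 2 * weight s j
labelling (suc m) s (suc i) j = 15 + 16 * m ∸ labelling m (not s) i j

labelling-zero≤8 : ∀ s j → 2 * weight s j ≤ 8
labelling-zero≤8 s j = *-monoʳ-≤ 2 (weight≤4 s j)

labelling-bound : ∀ m s i j → labelling (suc m) s i j ≤ 15 + 16 * m
labelling-bound m s zero j =
  ≤-trans (labelling-zero≤8 s j) (≤-trans (from-yes (8 ≤? 15)) (m≤m+n 15 _))
labelling-bound m s (suc i) j = m∸n≤m _ (labelling m (not s) i j)

-- Weaker by 16 than `labelling-bound`, but it covers `m = 0` too. It keeps the subtraction in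
-- `labelling` from truncating, so that this reflection is injective and preserves distances.
labelling≤ : ∀ m s i j → labelling m s i j ≤ 15 + 16 * m
labelling≤ zero s zero j = ≤-trans (labelling-zero≤8 s j) (from-yes (8 ≤? 15))
labelling≤ (suc m) s i j = ≤-trans (labelling-bound m s i j)
  (+-monoʳ-≤ 15 (*-monoʳ-≤ 16 (<⇒≤ ≤-refl)))

-- With two columns the ranges overlap, but the values are even in one column and odd in the other.
-- With more columns, column zero stays at most 8 while every later value is at least 16.
labelling-zero≢suc : ∀ m s i j j′ →
  labelling (suc m) s zero j ≢ labelling (suc m) s (suc i) j′
labelling-zero≢suc zero false zero = from-yes (all? λ j → all? λ j′ →
  ¬? (2 * weight false j ≟ 15 ∸ 2 * weight true j′))
labelling-zero≢suc zero true zero = from-yes (all? λ j → all? λ j′ →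
  ¬? (2 * weight true j ≟ 15 ∸ 2 * weight false j′))
labelling-zero≢suc (suc m) s i j j′ = <⇒≢ (begin-strict
  2 * weight s j                                       ≤⟨ labelling-zero≤8 s j ⟩
  8                                                    <⟨ from-yes (9 ≤? 16) ⟩
  16                                                   ≡⟨ m+n∸m≡n (15 + 16 * m) 16 ⟨
  (15 + 16 * m) + 16 ∸ (15 + 16 * m)                   ≡⟨ cong (_∸ (15 + 16 * m)) (shift m) ⟩
  15 + 16 * suc m ∸ (15 + 16 * m)                      ≤⟨ ∸-monoʳ-≤ (15 + 16 * suc m) (labelling-bound m (not s) i j′) ⟩
  15 + 16 * suc m ∸ labelling (suc m) (not s) i j′     ∎)
  where
  open ≤-Reasoning
  shift : ∀ x → 15 + 16 * x + 16 ≡ 15 + 16 * suc x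
  shift = solve-∀

labelling-injective : ∀ m s i i′ j j′ →
  labelling m s i j ≡ labelling m s i′ j′ → (i , j) ≡ (i′ , j′)
labelling-injective m s zero zero j j′ eq =
  cong (zero ,_) (weight-injective s j j′ (*-cancelˡ-≡ _ _ 2 eq))
labelling-injective (suc m) s zero (suc i′) j j′ eq =
  contradiction eq (labelling-zero≢suc m s i′ j j′)
labelling-injective (suc m) s (suc i) zero j j′ eq =
  contradiction (sym eq) (labelling-zero≢suc m s i j′ j)
labelling-injective (suc m) s (suc i) (suc i′) j j′ eq =
  cong (λ (i , j) → suc i , j) (labelling-injective m (not s) i i′ j j′
    (∸-cancelˡ-≡ (labelling≤ m (not s) i j) (labelling≤ m (not s) i′ j′) eq))

parity : ∀ {m} → Bool → Fin m → Bool
parity s zero    = s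
parity s (suc g) = parity (not s) g

-- Induction on `m`: the first pair of columns takes the top block of eight labels, and reflection
-- preserves all differences further right. Blocks thus descend from left to right, hence
-- `opposite`.
labelling-difference : ∀ m s (g : Fin m) t → let (j , j′) = rows (parity s g) t in
  ∣ labelling m s (inject₁ g) j - labelling m s (suc g) j′ ∣
    ≡ 2 * toℕ (combine (opposite g) t) + 1
labelling-difference (suc m) s zero t = begin
  ∣ 2 * w - 15 + 16 * m ∸ 2 * w′ ∣                    ≡⟨ cong (λ x → ∣ 2 * w - x ∸ 2 * w′ ∣) split ⟩
  ∣ 2 * w - 2 * w′ + (2 * w + d) ∸ 2 * w′ ∣           ≡⟨ cong ∣ 2 * w -_∣ (m+n∸m≡n (2 * w′) _) ⟩
  ∣ 2 * w - 2 * w + d ∣                               ≡⟨ ∣m-m+n∣≡n (2 * w) d ⟩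
  2 * (8 * m + toℕ t) + 1                             ≡⟨ cong (λ x → 2 * (8 * x + toℕ t) + 1) (toℕ-fromℕ m) ⟨
  2 * (8 * toℕ (opposite {suc m} zero) + toℕ t) + 1   ≡⟨ cong (λ x → 2 * x + 1) (toℕ-combine (opposite {suc m} zero) t) ⟨
  2 * toℕ (combine (opposite {suc m} zero) t) + 1     ∎
  where
  open ≡-Reasoning
  w w′ d : ℕ
  w  = weight s (proj₁ (rows s t))
  w′ = weight (not s) (proj₂ (rows s t))
  d  = 2 * (8 * m + toℕ t) + 1
  regroup : ∀ x y z u → 2 * (x + y + z) + 1 + 16 * u ≡ 2 * x + (2 * y + (2 * (8 * u + z) + 1))
  regroup = solve-∀
  -- Write 15 as 2 * 7 + 1 and replace 7 by `w′ + w + toℕ t`. The entry of column one is then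
  -- `2 * w + d`, so the difference is `d`.
  split : 15 + 16 * m ≡ 2 * w′ + (2 * w + d)
  split = trans (cong (λ x → 2 * x + 1 + 16 * m) (sym (rows-weight s t)))
                (regroup w′ w (toℕ t) m)
labelling-difference (suc m) s (suc g) t = begin
  ∣ 15 + 16 * m ∸ labelling m (not s) (inject₁ g) j - 15 + 16 * m ∸ labelling m (not s) (suc g) j′ ∣
    ≡⟨ ∣o∸m-o∸n∣≡∣m-n∣ (labelling≤ m (not s) (inject₁ g) j) (labelling≤ m (not s) (suc g) j′) ⟩
  ∣ labelling m (not s) (inject₁ g) j - labelling m (not s) (suc g) j′ ∣
    ≡⟨ labelling-difference m (not s) g t ⟩
  2 * toℕ (combine (opposite g) t) + 1
    ≡⟨ cong (λ x → 2 * x + 1) (toℕ-combine (opposite g) t) ⟩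
  2 * (8 * toℕ (opposite g) + toℕ t) + 1
    -- `opposite (suc g)` is `inject₁ (opposite g)`: a new first column leaves the block numbers of
    -- the others unchanged.
    ≡⟨ cong (λ x → 2 * (8 * x + toℕ t) + 1) (toℕ-inject₁ (opposite g)) ⟨
  2 * (8 * toℕ (inject₁ (opposite g)) + toℕ t) + 1
    ≡⟨ cong (λ x → 2 * x + 1) (toℕ-combine (inject₁ (opposite g)) t) ⟨
  2 * toℕ (combine (inject₁ (opposite g)) t) + 1
    ∎
  where
  open ≡-Reasoning
  j j′ : Fin 5
  j  = proj₁ (rows (parity (not s) g) t)
  j′ = proj₂ (rows (parity (not s) g) t)

consecutive : ∀ {m} (i i′ : Fin (suc m)) → suc (toℕ i) ≡ toℕ i′ →
              ∃[ g ] inject₁ g ≡ i × suc g ≡ i′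
consecutive i (suc g) eq =
  g , toℕ-injective (trans (toℕ-inject₁ g) (cong (_∸ 1) (sym eq))) , refl

module _ (m : ℕ) where

  private
    G : Graph
    G = path (suc m) ∧ path 5

  edge : Fin m → Fin 8 → Edge G
  edge g t =
    ((inject₁ g , proj₁ (rows (parity false g) t)) , (suc g , proj₂ (rows (parity false g) t))) ,
    (inj₁ (cong suc (toℕ-inject₁ g)) , rows-adjacent (parity false g) t)

  -- Division of `k` by 8 gives the block, counted from the last pair of columns, and the place `t`
  -- within it.
  enumeration : Fin (m * 8) → Edge G
  enumeration k = edge (opposite (proj₁ (remQuot 8 k))) (proj₂ (remQuot {m} 8 k))

  enumeration-combine : ∀ g t → enumeration (combine (opposite g) t) ≡ edge g t
  enumeration-combine g t = trans
    (cong (λ (h , t) → edge (opposite h) t) (remQuot-combine (opposite g) t))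
    (cong (λ h → edge h t) (opposite-involutive g))

  edge-surjective : ∀ d → ∃[ g ] ∃[ t ] _≈ᴱ_ G (edge g t) d
  edge-surjective (((i , j) , (i′ , j′)) , inj₁ i→i′ , jj′)
    with g , refl , refl ← consecutive i i′ i→i′
    with t , eq ← rows-surjective (parity false g) j j′ jj′ =
    g , t , inj₁ (cong (λ (j , j′) → (inject₁ g , j) , (suc g , j′)) eq)
  -- `edge` always runs from left to right, so an edge given from right to left is matched after
  -- swapping its ends.
  edge-surjective (((i , j) , (i′ , j′)) , inj₂ i′→i , jj′)
    with g , refl , refl ← consecutive i′ i i′→i
    with t , eq ← rows-surjective (parity false g) j′ j (adj-sym (path 5) {j} {j′} jj′) =
    g , t , inj₂ (cong (λ (j′ , j) → (inject₁ g , j′) , (suc g , j)) eq)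

  enumeration-surjective : ∀ d → ∃[ k ] _≈ᴱ_ G (enumeration k) d
  enumeration-surjective d with g , t , eq ← edge-surjective d =
    combine (opposite g) t ,
    subst (λ e → _≈ᴱ_ G e d) (sym (enumeration-combine g t)) eq

  enumeration-label : ∀ k →
    edgeLabel G (λ (i , j) → labelling m false i j) (enumeration k) ≡ 2 * toℕ k + 1
  enumeration-label k = trans
    (labelling-difference m false (opposite h) t)
    (cong (λ x → 2 * toℕ x + 1)
      (trans (cong (λ x → combine x t) (opposite-involutive h)) (combine-remQuot {m} 8 k)))
    where
    h = proj₁ (remQuot {m} 8 k)
    t = proj₂ (remQuot {m} 8 k)

theorem4 : (n : ℕ) → n > 2 → OddGraceful (path n ∧ path 5)
theorem4 (suc (suc m)) _ = oddGraceful-byEnumeration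
  (path (suc (suc m)) ∧ path 5)
  (λ (i , j) → labelling (suc m) false i j)
  (suc m * 8)
  (enumeration (suc m))
  (enumeration-label (suc m))
  (enumeration-surjective (suc m))
  (λ {(i , j)} {(i′ , j′)} → labelling-injective (suc m) false i i′ j j′)
  -- Here n is `suc (suc m)`, so there are `suc m` pairs of columns, and the bound `15 + 16 * m` is
  -- exactly 2q - 1.
  (λ (i , j) → subst (labelling (suc m) false i j <_) (total m)
    (s≤s (labelling-bound m false i j)))
  where
  total : ∀ x → suc (15 + 16 * x) ≡ 2 * (suc x * 8)
  total = solve-∀
theorem4 (suc zero) (s≤s ())
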